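{- Let $G$ be a planar bipartite graph with maximum degree $\Delta$, and let $H$ be a subgraph of $G$. If $H$ has maximum degree at most $d$, then any total-$(\Delta+d+4)$-coloring of $H$ in $G$ can be extended to $G$.
   Context: All graphs are finite and simple. A total-$k$-coloring of a graph is an assignment of colors from $\{1,\dots,k\}$ to its vertices and edges such that adjacent vertices get distinct colors, edges sharing an endpoint get distinct colors, and no edge gets the same color as either of its endpoints. A total-$k$-coloring $\varphi$ of a subgraph $H$ of $G$ is a total-$k$-coloring of $H$ in $G$ if additionally there are no vertices $u,v$ adjacent in $G$ but not in $H$ with $\varphi(u)=\varphi(v)$. The coloring $\varphi$ extends to $G$ if there is a total-$k$-coloring of $G$ agreeing with $\varphi$ on all vertices and edges of $H$. -}

module Defs where

open import Data.Nat using (ℕ; zero; suc; _+_; _*_; _≤_; _<ᵇ_; _≡ᵇ_; _⊔_)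
open import Data.Fin using (Fin; toℕ; _≟_)
open import Data.Bool using (Bool; true; false; T; _∧_; _∨_; not; if_then_else_)
open import Data.List using (List; allFin; foldr; map; upTo)
open import Data.Nat.ListAction using (sum)
open import Data.Bool.ListAction using (any; all)
open import Data.Product using (Σ; _×_; _,_; ∃; ∃-syntax)
open import Relation.Nullary using (¬_)
open import Relation.Nullary.Decidable using (⌊_⌋)
open import Relation.Binary.PropositionalEquality using (_≡_; _≢_)

record Graph (n : ℕ) : Set where
  field
    adj    : Fin n → Fin n → Bool
    irrefl : ∀ v → adj v v ≡ false
    sym    : ∀ u v → adj u v ≡ adj v u
open Graph public

count : ∀ {n} → (Fin n → Bool) → ℕ
count {n} p = sum (map (λ x → if p x then 1 else 0) (allFin n))

iter : ∀ {A : Set} → (A → A) → ℕ → A → A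
iter f zero    a = a
iter f (suc i) a = f (iter f i a)

eqB : ∀ {n} → Fin n → Fin n → Bool
eqB u v = ⌊ u ≟ v ⌋

deg : ∀ {n} → Graph n → Fin n → ℕ
deg G v = count (adj G v)

maxDeg : ∀ {n} → Graph n → ℕ
maxDeg {n} G = foldr _⊔_ 0 (map (deg G) (allFin n))

Bipartite : ∀ {n} → Graph n → Set
Bipartite {n} G = Σ (Fin n → Bool) λ side →
  ∀ u v → T (adj G u v) → side u ≢ side v

reachB : ∀ {n} → Graph n → ℕ → Fin n → Fin n → Bool
reachB G zero    u v = eqB u v
reachB {n} G (suc k) u v =
  reachB G k u v ∨ any (λ w → reachB G k u w ∧ adj G w v) (allFin n)

components : ∀ {n} → Graph n → ℕ
components {n} G =
  count (λ v → not (any (λ u → (toℕ u <ᵇ toℕ v) ∧ reachB G n u v) (allFin n)))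

isolated : ∀ {n} → Graph n → ℕ
isolated G = count (λ v → deg G v ≡ᵇ 0)

-- number of darts (ordered adjacent pairs) = 2|E|
darts : ∀ {n} → Graph n → ℕ
darts {n} G = sum (map (deg G) (allFin n))

-- rotation system: ρ u is a cyclic permutation of the neighbours of u
IsRotation : ∀ {n} → Graph n → (Fin n → Fin n → Fin n) → Set
IsRotation G ρ =
  (∀ u v → T (adj G u v) → T (adj G u (ρ u v))) ×
  (∀ u v w → T (adj G u v) → T (adj G u w) → ∃[ i ] iter (ρ u) i v ≡ w)

faceMap : ∀ {n} → (Fin n → Fin n → Fin n) → Fin n × Fin n → Fin n × Fin n
faceMap ρ (u , v) = v , ρ v u

dartKey : ∀ {n} → Fin n × Fin n → ℕ
dartKey {n} (u , v) = toℕ u * n + toℕ v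

faces : ∀ {n} → Graph n → (Fin n → Fin n → Fin n) → ℕ
faces {n} G ρ = sum (map (λ u → count (λ v → adj G u v ∧ leastInOrbit (u , v))) (allFin n))
  where
  leastInOrbit : Fin n × Fin n → Bool
  leastInOrbit d = all (λ i → not (dartKey (iter (faceMap ρ) i d) <ᵇ dartKey d)) (upTo (n * n))

-- G is planar iff it has a rotation system for which every component has
-- Euler characteristic 2: V - E + F = 2·(#components), where an isolated
-- vertex counts as one face of its (trivial) component.
Planar : ∀ {n} → Graph n → Set
Planar {n} G = Σ (Fin n → Fin n → Fin n) λ ρ →
  IsRotation G ρ ×
  (2 * (n + (faces G ρ + isolated G)) ≡ darts G + 4 * components G)

record Subgraph {n : ℕ} (G : Graph n) : Set where
  field
    inV  : Fin n → Bool
    hadj : Fin n → Fin n → Bool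
    hsym : ∀ u v → hadj u v ≡ hadj v u
    hsub : ∀ u v → T (hadj u v) → T (adj G u v)
    hend : ∀ u v → T (hadj u v) → T (inV u)
open Subgraph public

hdeg : ∀ {n} {G : Graph n} → Subgraph G → Fin n → ℕ
hdeg H v = count (hadj H v)

IsTotalColoring : ∀ {n k} → (G : Graph n) → (Fin n → Fin k) → (Fin n → Fin n → Fin k) → Set
IsTotalColoring G vc ec =
  (∀ u v → T (adj G u v) → vc u ≢ vc v) ×
  (∀ u v → T (adj G u v) → ec u v ≡ ec v u) ×
  (∀ u v w → T (adj G u v) → T (adj G u w) → v ≢ w → ec u v ≢ ec u w) ×
  (∀ u v → T (adj G u v) → ec u v ≢ vc u)

-- total-k-colouring of H in G (colours of vertices outside H / edges outside H are ignored)
IsTotalColoringIn : ∀ {n k} → (G : Graph n) → Subgraph G →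
  (Fin n → Fin k) → (Fin n → Fin n → Fin k) → Set
IsTotalColoringIn G H vc ec =
  (∀ u v → T (inV H u) → T (inV H v) → T (adj G u v) → vc u ≢ vc v) ×
  (∀ u v → T (hadj H u v) → ec u v ≡ ec v u) ×
  (∀ u v w → T (hadj H u v) → T (hadj H u w) → v ≢ w → ec u v ≢ ec u w) ×
  (∀ u v → T (hadj H u v) → ec u v ≢ vc u)

Extends : ∀ {n k} → (G : Graph n) → Subgraph G →
  (Fin n → Fin k) → (Fin n → Fin n → Fin k) → Set
Extends {n} {k} G H vc ec =
  Σ (Fin n → Fin k) λ vc′ → Σ (Fin n → Fin n → Fin k) λ ec′ →
    IsTotalColoring G vc′ ec′ ×
    (∀ v → T (inV H v) → vc′ v ≡ vc v) ×
    (∀ u v → T (hadj H u v) → ec′ u v ≡ ec u v)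

{-# OPTIONS --safe #-}
-- Vertices outside H are coloured greedily.  An edge xy of G − E(H) then has at least
-- Δ + d + 2 − deg_H x − deg_H y admissible colours, hence at least the larger degree of its ends in the
-- bipartite graph B = G − E(H), and the theorem of Borodin, Kostochka and Woodall colours B from these
-- lists.  Galvin's kernel method reduces that theorem to ranking the edges at every vertex
-- so that the ranks of xy at x and y add up to less than max(deg x, deg y).  Such ranks arise by
-- peeling off matchings M in which deg y < deg x whenever xy is an edge with x covered and y not (or
-- the same with the sides exchanged): M goes first at the rows and last at the columns.  A suitable M
-- comes from applying Hall's theorem to the edges with deg x ≤ deg y, and to those with deg y ≤ deg x.
module Submission where

open import Defs
open import Data.Nat using (ℕ; zero; suc; pred; _+_; _≤_; _<_; _⊔_; z≤n; s≤s; _<?_; _≤?_)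
open import Data.Nat.Induction using (<-wellFounded)
open import Data.Nat.Properties hiding (_≟_; suc-injective)
open import Data.Fin using (Fin; zero; suc; fromℕ<; remQuot; combine)
open import Data.Fin.Properties using (_≟_; any?; all?; suc-injective; fromℕ<-injective; remQuot-combine)
open import Data.Bool using (Bool; true; false; T; if_then_else_)
open import Data.Bool.Properties using (T?)
open import Data.List using (_∷_; allFin; foldr)
open import Data.List.Membership.Propositional using (_∈_)
open import Data.List.Membership.Propositional.Properties using (∈-map⁺; ∈-allFin)
open import Data.List.Properties using (map-tabulate)
open import Data.List.Relation.Unary.Any using (here; there)
open import Data.Nat.ListAction using (sum)
open import Data.Product using (Σ; _×_; _,_; ∃; ∃-syntax; proj₁; proj₂; uncurry)
open import Data.Sum using (_⊎_; inj₁; inj₂)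
open import Data.Unit using (tt)
open import Data.Vec.Functional using (updateAt) renaming (_∷_ to _∷ᵛ_)
open import Data.Vec.Functional.Properties using (updateAt-updates; updateAt-minimal)
open import Function using (_∘_; id; const; flip)
open import Induction.WellFounded using (Acc; acc)
open import Relation.Binary.Definitions using (tri<; tri≈; tri>)
open import Relation.Binary.PropositionalEquality
  using (_≡_; _≢_; refl; cong; subst; trans)
  renaming (sym to ≡-sym)
open import Relation.Nullary using (¬_; Dec; yes; no; contradiction)
open import Relation.Nullary.Decidable
  using (⌊_⌋; toWitness; fromWitness; decidable-stable; _×-dec_; _⊎-dec_; _→-dec_; ¬?)

open import Algebra.Properties.CommutativeSemigroup +-commutativeSemigroup using (interchange)

private
  variable
    k m n : ℕ

-- Counting

𝟙 : Bool → ℕ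
𝟙 b = if b then 1 else 0

𝟙-mono : ∀ a b → (T a → T b) → 𝟙 a ≤ 𝟙 b
𝟙-mono false b     h = z≤n
𝟙-mono true  true  h = ≤-refl
𝟙-mono true  false h with () ← h tt

𝟙-strict : ∀ a b → ¬ T a → T b → 𝟙 a < 𝟙 b
𝟙-strict false true  ¬a b = ≤-refl
𝟙-strict true  true  ¬a b = contradiction tt ¬a

count-suc : (p : Fin (suc n) → Bool) → count p ≡ 𝟙 (p zero) + count (p ∘ suc)
count-suc {n} p = cong (λ l → 𝟙 (p zero) + sum l)
  (trans (map-tabulate {n = n} suc (𝟙 ∘ p)) (≡-sym (map-tabulate id (𝟙 ∘ p ∘ suc))))

count-mono : (p q : Fin n → Bool) → (∀ i → T (p i) → T (q i)) → count p ≤ count q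
count-mono {zero}  p q h = z≤n
count-mono {suc n} p q h rewrite count-suc p | count-suc q =
  +-mono-≤ (𝟙-mono (p zero) (q zero) (h zero)) (count-mono (p ∘ suc) (q ∘ suc) (h ∘ suc))

count-strict : (p q : Fin n → Bool) → (∀ i → T (p i) → T (q i)) →
  ∀ i → ¬ T (p i) → T (q i) → count p < count q
count-strict p q h zero ¬p q₀ rewrite count-suc p | count-suc q =
  +-mono-<-≤ (𝟙-strict (p zero) (q zero) ¬p q₀) (count-mono (p ∘ suc) (q ∘ suc) (h ∘ suc))
count-strict p q h (suc i) ¬p qᵢ rewrite count-suc p | count-suc q =
  +-mono-≤-< (𝟙-mono (p zero) (q zero) (h zero))
             (count-strict (p ∘ suc) (q ∘ suc) (h ∘ suc) i ¬p qᵢ)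

_-_ : (Fin n → Bool) → Fin n → Fin n → Bool
(p - j) i = ⌊ T? (p i) ×-dec ¬? (i ≟ j) ⌋

count-minus : (p : Fin n → Bool) (j : Fin n) → T (p j) → count (p - j) < count p
count-minus p j = count-strict (p - j) p (λ i → proj₁ ∘ toWitness) j
  (λ t → proj₂ (toWitness t) refl)

-- The map takes a proof of `T (p i)`, so it may be partial. The value at `zero` is removed from
-- `q`, and injectivity keeps the remaining values away from it.
count-injection : (p : Fin m → Bool) (q : Fin n → Bool) (f : ∀ i → T (p i) → Fin n) →
  (∀ i j pi pj → f i pi ≡ f j pj → i ≡ j) → (∀ i pi → T (q (f i pi))) → count p ≤ count q
count-injection {zero}  p q f inj maps = z≤n
count-injection {suc m} p q f inj maps rewrite count-suc p with T? (p zero)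
... | no ¬p₀ = +-mono-≤ (𝟙-mono (p zero) false ¬p₀) (count-injection (p ∘ suc) q (f ∘ suc)
      (λ i j pi pj e → suc-injective (inj (suc i) (suc j) pi pj e)) (maps ∘ suc))
... | yes p₀ = ≤-trans
  (+-mono-≤ (𝟙-mono (p zero) true _) (count-injection (p ∘ suc) (q - f zero p₀) (f ∘ suc)
    (λ i j pi pj e → suc-injective (inj (suc i) (suc j) pi pj e))
    (λ i pi → fromWitness (maps (suc i) pi ,
       λ e → contradiction (inj (suc i) zero pi p₀ e) λ ()))))
  (count-minus q (f zero p₀) (maps zero p₀))

count-full : ∀ n → count {n} (const true) ≡ n
count-full zero    = refl
count-full (suc n) = trans (count-suc {n} (const true)) (cong suc (count-full n))

count-∪ : (p q r : Fin n → Bool) → (∀ i → T (r i) → T (p i) ⊎ T (q i)) →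
  count r ≤ count p + count q
count-∪ {zero}  p q r h = z≤n
count-∪ {suc n} p q r h
  rewrite count-suc p | count-suc q | count-suc r
        -- Regrouping puts the bits at index zero together, which leaves one Boolean inequality and
        -- the inductive hypothesis.
        | interchange (𝟙 (p zero)) (count (p ∘ suc)) (𝟙 (q zero)) (count (q ∘ suc)) =
  +-mono-≤ (bit (p zero) (q zero) (r zero) (h zero))
           (count-∪ (p ∘ suc) (q ∘ suc) (r ∘ suc) (h ∘ suc))
  where
  bit : ∀ a b c → (T c → T a ⊎ T b) → 𝟙 c ≤ 𝟙 a + 𝟙 b
  bit a     b     false h = z≤n
  bit true  b     true  h = s≤s z≤n
  bit false true  true  h = ≤-refl
  bit false false true  h with h tt
  ... | inj₁ ()
  ... | inj₂ ()

count-disjoint : (p q r : Fin n → Bool) → (∀ i → T (p i) → T (r i)) →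
  (∀ i → T (q i) → T (r i)) → (∀ i → T (p i) → ¬ T (q i)) → count p + count q ≤ count r
count-disjoint {zero}  p q r hp hq d = z≤n
count-disjoint {suc n} p q r hp hq d
  rewrite count-suc p | count-suc q | count-suc r
        | interchange (𝟙 (p zero)) (count (p ∘ suc)) (𝟙 (q zero)) (count (q ∘ suc)) =
  +-mono-≤ (bit (p zero) (q zero) (r zero) (hp zero) (hq zero) (d zero))
           (count-disjoint (p ∘ suc) (q ∘ suc) (r ∘ suc) (hp ∘ suc) (hq ∘ suc) (d ∘ suc))
  where
  bit : ∀ a b c → (T a → T c) → (T b → T c) → (T a → ¬ T b) → 𝟙 a + 𝟙 b ≤ 𝟙 c
  bit false b     c     ha hb d = 𝟙-mono b c hb
  bit true  true  c     ha hb d = contradiction tt (d tt)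
  bit true  false true  ha hb d = ≤-refl
  bit true  false false ha hb d with () ← ha tt

image : (Fin m → Bool) → (Fin m → Fin k) → Fin k → Bool
image p f c = ⌊ any? (λ u → T? (p u) ×-dec (f u ≟ c)) ⌋

-- Sending each value to the preimage found by the search is injective, since `f` recovers the
-- value.
count-image : (p : Fin m → Bool) (f : Fin m → Fin k) → count (image p f) ≤ count p
count-image p f = count-injection (image p f) p (λ c t → proj₁ (toWitness t))
  (λ c c′ t t′ e → trans (≡-sym (proj₂ (proj₂ (toWitness t))))
     (trans (cong f e) (proj₂ (proj₂ (toWitness t′)))))
  (λ c t → proj₁ (proj₂ (toWitness t)))

-- Pigeonhole: if every colour were hit, the image would have `k` elements, more than `p` has.
free-value : (p : Fin m → Bool) (f : Fin m → Fin k) → count p < k →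
  ∃[ c ] ∀ u → T (p u) → f u ≢ c
free-value {m} {k} p f p<k with any? (λ c → ¬? (T? (image p f c)))
... | yes (c , ¬im) = c , λ u pu e → ¬im (fromWitness (u , pu , e))
... | no  ¬∃ = contradiction
  (subst (_≤ count p) (count-full k)
    (≤-trans (count-mono (const true) (image p f)
       (λ c _ → decidable-stable (T? (image p f c)) (λ ¬im → ¬∃ (c , ¬im))))
     (count-image p f)))
  (<⇒≱ p<k)

-- The key itself is an injection into `Fin N`. This turns the rank of an edge into a bound on the
-- number of its competitors.
count-below : (p : Fin n → Bool) (key : Fin n → ℕ) →
  (∀ i j → T (p i) → T (p j) → key i ≡ key j → i ≡ j) →
  ∀ N → count (λ i → ⌊ T? (p i) ×-dec (key i <? N) ⌋) ≤ N
count-below p key inj N = ≤-trans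
  (count-injection _ (const true) (λ i t → fromℕ< (proj₂ (toWitness t)))
    (λ i j t t′ e → inj i j (proj₁ (toWitness t)) (proj₁ (toWitness t′))
       (fromℕ<-injective _ _ (proj₂ (toWitness t)) (proj₂ (toWitness t′)) e))
    (λ _ _ → tt))
  (≤-reflexive (count-full N))

argmin : (p : Fin n → Bool) (key : Fin n → ℕ) → ∀ i → T (p i) →
  ∃[ j ] T (p j) × (∀ l → T (p l) → key j ≤ key l)
argmin p key i pi = go i pi (<-wellFounded (key i))
  where
  go : ∀ i → T (p i) → Acc _<_ (key i) → ∃[ j ] T (p j) × (∀ l → T (p l) → key j ≤ key l)
  go i pi (acc rec) with any? (λ l → T? (p l) ×-dec (key l <? key i))
  ... | yes (l , pl , l<i) = go l pl (rec l<i)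
  ... | no ¬∃ = i , pi , λ l pl → ≮⇒≥ (λ l<i → ¬∃ (l , pl , l<i))

-- Bipartite graphs, given by their biadjacency matrices

Edges : ℕ → ℕ → Set
Edges m n = Fin m → Fin n → Bool

_∖_ : Edges m n → Edges m n → Edges m n
(B ∖ M) x y = ⌊ T? (B x y) ×-dec ¬? (T? (M x y)) ⌋

rowDeg : Edges m n → Fin m → ℕ
rowDeg B x = count (B x)

colDeg : Edges m n → Fin n → ℕ
colDeg B = rowDeg (flip B)

-- A single count over `Fin (m * n)`, so that strict monotonicity of `count` makes it a termination
-- measure for deleting edges.
size : Edges m n → ℕ
size {m} {n} B = count (uncurry B ∘ remQuot {m} n)

size-strict : (A B : Edges m n) → (∀ x y → T (A x y) → T (B x y)) →
  ∀ x y → ¬ T (A x y) → T (B x y) → size A < size B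
size-strict {m} {n} A B A⊆B x y ¬a b =
  count-strict (uncurry A ∘ remQuot {m} n) (uncurry B ∘ remQuot {m} n)
    (λ i → A⊆B _ _) (combine x y)
    (λ t → ¬a (subst (T ∘ uncurry A) (remQuot-combine x y) t))
    (subst (T ∘ uncurry B) (≡-sym (remQuot-combine x y)) b)

record IsMatching (B M : Edges m n) : Set where
  field
    sub    : ∀ x y → T (M x y) → T (B x y)
    rowUnq : ∀ x y y′ → T (M x y) → T (M x y′) → y ≡ y′
    colUnq : ∀ x x′ y → T (M x y) → T (M x′ y) → x ≡ x′
open IsMatching

-- Stable matchings

RowInjective : Edges m n → (Fin m → Fin n → ℕ) → Set
RowInjective B key = ∀ x y y′ → T (B x y) → T (B x y′) → key x y ≡ key x y′ → y ≡ y′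

-- Smaller keys are preferred. When `M` is a matching in `B`, this says that `M` is a kernel of the
-- line graph of `B`, with each edge pointing to the edges preferred to it at a common end.
IsStable : (kX : Fin m → Fin n → ℕ) (kY : Fin n → Fin m → ℕ) (B M : Edges m n) → Set
IsStable kX kY B M = ∀ x y → T (B x y) → ¬ T (M x y) →
  (∃[ y′ ] T (M x y′) × kX x y′ < kX x y) ⊎ (∃[ x′ ] T (M x′ y) × kY y x′ < kY y x)

-- If two rows have the same favourite column, the edge that this column likes less can be deleted:
-- whatever dominates the other edge at the column also dominates the deleted one.
stable-matching : (kX : Fin m → Fin n → ℕ) (kY : Fin n → Fin m → ℕ) (B : Edges m n) →
  RowInjective B kX → RowInjective (flip B) kY →
  ∃[ M ] IsMatching B M × IsStable kX kY B M
stable-matching {m} {n} kX kY B = go B (<-wellFounded (size B))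
  where
  go : (B : Edges m n) → Acc _<_ (size B) → RowInjective B kX → RowInjective (flip B) kY →
    ∃[ M ] IsMatching B M × IsStable kX kY B M
  go B (acc rec) injX injY = conflict (any? λ x → any? λ x′ → any? λ y →
      T? (top x y) ×-dec T? (top x′ y) ×-dec (kY y x <? kY y x′))
    where
    top : Edges m n
    top x y = ⌊ T? (B x y) ×-dec all? (λ y′ → T? (B x y′) →-dec (kX x y ≤? kX x y′)) ⌋

    top⇒B : ∀ {x y} → T (top x y) → T (B x y)
    top⇒B t = proj₁ (toWitness t)

    top-least : ∀ {x y} → T (top x y) → ∀ y′ → T (B x y′) → kX x y ≤ kX x y′
    top-least t = proj₂ (toWitness t)

    conflict : Dec (∃[ x ] ∃[ x′ ] ∃[ y ] T (top x y) × T (top x′ y) × kY y x < kY y x′) →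
      ∃[ M ] IsMatching B M × IsStable kX kY B M
    -- Without a conflict the favourite edges of the rows form a matching, and any other edge is
    -- beaten at its row by the favourite there.
    conflict (no ¬∃) = top , matching , stable
      where
      matching : IsMatching B top
      matching .sub x y = top⇒B
      matching .rowUnq x y y′ t t′ = injX x y y′ (top⇒B t) (top⇒B t′)
        (≤-antisym (top-least t y′ (top⇒B t′)) (top-least t′ y (top⇒B t)))
      matching .colUnq x x′ y t t′ with <-cmp (kY y x) (kY y x′)
      ... | tri< lt _ _ = contradiction (x , x′ , y , t , t′ , lt) ¬∃
      ... | tri≈ _ eq _ = injY y x x′ (top⇒B t) (top⇒B t′) eq
      ... | tri> _ _ gt = contradiction (x′ , x , y , t′ , t , gt) ¬∃
      stable : IsStable kX kY B top
      stable x y b ¬t with argmin (B x) (kX x) y b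
      ... | y₀ , b₀ , least = inj₁ (y₀ , fromWitness (b₀ , least) , ≤∧≢⇒< (least y b) ≢)
        where
        ≢ : kX x y₀ ≢ kX x y
        ≢ e with refl ← injX x y₀ y b₀ b e = ¬t (fromWitness (b₀ , least))
    conflict (yes (x , x′ , y , t , t′ , lt)) = extend (go B⁻ (rec smaller)
      (λ u v w p q → injX u v w (B⁻⊆B u v p) (B⁻⊆B u w q))
      (λ u v w p q → injY u v w (B⁻⊆B v u p) (B⁻⊆B w u q)))
      where
      B⁻ : Edges m n
      B⁻ u v = ⌊ T? (B u v) ×-dec ¬? ((u ≟ x′) ×-dec (v ≟ y)) ⌋
      B⁻⊆B : ∀ u v → T (B⁻ u v) → T (B u v)
      B⁻⊆B u v = proj₁ ∘ toWitness
      smaller : size B⁻ < size B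
      smaller = size-strict B⁻ B B⁻⊆B x′ y (λ p → proj₂ (toWitness p) (refl , refl)) (top⇒B t′)
      kept : T (B⁻ x y)
      kept = fromWitness (top⇒B t , λ (e , _) → <-irrefl (cong (kY y) e) lt)
      extend : (∃[ M ] IsMatching B⁻ M × IsStable kX kY B⁻ M) →
        ∃[ M ] IsMatching B M × IsStable kX kY B M
      extend (M , matching , stable) = M ,
        record { sub = λ u v → B⁻⊆B u v ∘ sub matching u v
               ; rowUnq = rowUnq matching ; colUnq = colUnq matching } , stable⁺
        where
        stable⁺ : IsStable kX kY B M
        stable⁺ u v b ¬μ with u ≟ x′ | v ≟ y
        ... | no u≢  | _      = stable u v (fromWitness (b , u≢ ∘ proj₁)) ¬μ
        ... | yes _  | no v≢  = stable u v (fromWitness (b , v≢ ∘ proj₂)) ¬μ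
        ... | yes refl | yes refl with T? (M x y)
        ...   | yes μ = inj₂ (x , μ , lt)
        ...   | no ¬μ′ with stable x y kept ¬μ′
        -- `xy` is the favourite edge of `x`, so it can be dominated only at its column.
        ...     | inj₁ (y₁ , μ₁ , lt₁) =
                    contradiction (top-least t y₁ (B⁻⊆B x y₁ (sub matching x y₁ μ₁))) (<⇒≱ lt₁)
        ...     | inj₂ (x₁ , μ₁ , lt₁) = inj₂ (x₁ , μ₁ , <-trans lt₁ lt)

-- Galvin's kernel method

Better : (B : Edges m n) → (Fin m → Fin n → ℕ) → Fin m → Fin n → Fin n → Bool
Better B key x y y′ = ⌊ T? (B x y′) ×-dec (key x y′ <? key x y) ⌋

-- One colour at a time: give it to a stable matching of the uncoloured edges that admit it; every
-- other such edge loses a colour of its list but also a competitor at one of its ends.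
galvin : (kX : Fin m → Fin n → ℕ) (kY : Fin n → Fin m → ℕ) (B : Edges m n)
  (L : Fin m → Fin n → Fin k → Bool) →
  RowInjective B kX → RowInjective (flip B) kY →
  (∀ x y → T (B x y) →
    count (Better B kX x y) + count (Better (flip B) kY y x) < count (L x y)) →
  Σ (Fin k → Edges m n) λ C →
    (∀ c → IsMatching (λ x y → L x y c) (C c)) × (∀ x y → T (B x y) → ∃[ c ] T (C c x y))
galvin {k = zero} kX kY B L injX injY enough =
  (λ ()) , (λ ()) , λ x y b → contradiction (enough x y b) λ ()
galvin {m} {n} {suc k} kX kY B L injX injY enough = step (stable-matching kX kY B₀
  (λ x y y′ b b′ → injX x y y′ (proj₁ (toWitness b)) (proj₁ (toWitness b′)))
  (λ y x x′ b b′ → injY y x x′ (proj₁ (toWitness b)) (proj₁ (toWitness b′))))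
  where
  B₀ : Edges m n
  B₀ x y = ⌊ T? (B x y) ×-dec T? (L x y zero) ⌋

  Coloured : Set
  Coloured = Σ (Fin (suc k) → Edges m n) λ C →
    (∀ c → IsMatching (λ x y → L x y c) (C c)) × (∀ x y → T (B x y) → ∃[ c ] T (C c x y))

  step : ∃[ M ] IsMatching B₀ M × IsStable kX kY B₀ M → Coloured
  step (M , matching , stable) = extend (galvin kX kY (B ∖ M) (λ x y → L x y ∘ suc)
    (λ x y y′ b b′ → injX x y y′ (proj₁ (toWitness b)) (proj₁ (toWitness b′)))
    (λ y x x′ b b′ → injY y x x′ (proj₁ (toWitness b)) (proj₁ (toWitness b′)))
    enough′)
    where
    extend : (Σ (Fin k → Edges m n) λ C → (∀ c → IsMatching (λ x y → L x y (suc c)) (C c)) ×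
                (∀ x y → T ((B ∖ M) x y) → ∃[ c ] T (C c x y))) → Coloured
    extend (C , classes , covers) = C⁺ , classes⁺ , covers⁺
      where
      C⁺ : Fin (suc k) → Edges m n
      C⁺ zero    = M
      C⁺ (suc c) = C c

      classes⁺ : ∀ c → IsMatching (λ x y → L x y c) (C⁺ c)
      classes⁺ zero = record
        { sub = λ x y μ → proj₂ (toWitness (sub matching x y μ))
        ; rowUnq = rowUnq matching ; colUnq = colUnq matching }
      classes⁺ (suc c) = classes c

      covers⁺ : ∀ x y → T (B x y) → ∃[ c ] T (C⁺ c x y)
      covers⁺ x y b with T? (M x y)
      ... | yes μ = zero , μ
      ... | no ¬μ with c , h ← covers x y (fromWitness (b , ¬μ)) = suc c , h

    enough′ : ∀ x y → T ((B ∖ M) x y) →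
      count (Better (B ∖ M) kX x y) + count (Better (flip (B ∖ M)) kY y x) < count (L x y ∘ suc)
    enough′ x y b⁻ = bound (L x y zero) refl
      where
      b : T (B x y)
      b = proj₁ (toWitness b⁻)
      fewerX : ∀ y′ → T (Better (B ∖ M) kX x y y′) → T (Better B kX x y y′)
      fewerX y′ t = fromWitness (proj₁ (toWitness (proj₁ (toWitness t))) , proj₂ (toWitness t))
      fewerY : ∀ x′ → T (Better (flip (B ∖ M)) kY y x x′) → T (Better (flip B) kY y x x′)
      fewerY x′ t = fromWitness (proj₁ (toWitness (proj₁ (toWitness t))) , proj₂ (toWitness t))
      monoX : count (Better (B ∖ M) kX x y) ≤ count (Better B kX x y)
      monoX = count-mono _ _ fewerX
      monoY : count (Better (flip (B ∖ M)) kY y x) ≤ count (Better (flip B) kY y x)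
      monoY = count-mono _ _ fewerY
      gone : ∀ {x′ y′} → T (M x′ y′) → ¬ T ((B ∖ M) x′ y′)
      gone μ t = proj₂ (toWitness t) μ

      drop : T (L x y zero) →
        suc (count (Better (B ∖ M) kX x y) + count (Better (flip (B ∖ M)) kY y x)) ≤
        count (Better B kX x y) + count (Better (flip B) kY y x)
      drop l with stable x y (fromWitness (b , l)) (proj₂ (toWitness b⁻))
      ... | inj₁ (y′ , μ , lt) = +-mono-≤ (count-strict _ _ fewerX y′
              (gone μ ∘ proj₁ ∘ toWitness)
              (fromWitness (proj₁ (toWitness (sub matching x y′ μ)) , lt))) monoY
      ... | inj₂ (x′ , μ , lt) = +-mono-≤-< monoX (count-strict _ _ fewerY x′
              (gone μ ∘ proj₁ ∘ toWitness)
              (fromWitness (proj₁ (toWitness (sub matching x′ y μ)) , lt)))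

      short : ∀ l → L x y zero ≡ l →
        count (Better B kX x y) + count (Better (flip B) kY y x) < 𝟙 l + count (L x y ∘ suc)
      short l eq = ≤-trans (enough x y b) (≤-reflexive
        (trans (count-suc (L x y)) (cong (λ l → 𝟙 l + count (L x y ∘ suc)) eq)))

      bound : ∀ l → L x y zero ≡ l →
        count (Better (B ∖ M) kX x y) + count (Better (flip (B ∖ M)) kY y x) < count (L x y ∘ suc)
      -- The list loses colour zero, and `drop` pays for it with a lost competitor. In the other
      -- case the list keeps its length.
      bound true  eq = ≤-pred (≤-trans (s≤s (drop (subst T (≡-sym eq) tt))) (short true eq))
      bound false eq = ≤-<-trans (+-mono-≤ monoX monoY) (short false eq)

-- Hall's theorem

-- A system of distinct representatives for the rows in `P`; the values of `f` at other rows are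
-- arbitrary.
SDR : Edges m n → (Fin m → Set) → (Fin m → Fin n) → Set
SDR R P f = (∀ u → P u → T (R u (f u))) × (∀ u v → P u → P v → f u ≡ f v → u ≡ v)

-- A Hall violator S that is tight up to one element: f matches S minus its root onto N(S).
record Deficient (R : Edges m n) (X : Fin m → Bool) : Set where
  field
    S      : Fin m → Bool
    root   : Fin m
    root∈S : T (S root)
    root∈X : T (X root)
    f      : Fin m → Fin n
    sdr    : SDR R (λ u → T (S u) × u ≢ root) f
    closed : ∀ u y → T (S u) → T (R u y) → ∃[ v ] (T (S v) × v ≢ root) × f v ≡ y

-- S is the set of rows reached from x by alternating paths; each s in S can be exchanged with x,
-- that is, left uncovered instead of x by a system that differs from f on S only.
augment : (R : Edges m n) (X : Fin m → Bool) (x : Fin m) → T (X x) →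
  (f : Fin m → Fin n) → SDR R (λ u → T (X u) × u ≢ x) f →
  (∃[ g ] SDR R (T ∘ X) g) ⊎ Deficient R X
augment {m} {n} R X x x∈X f (f-edge , f-inj) =
  search S₀ (<-wellFounded _) (λ u t → subst (T ∘ X) (≡-sym (toWitness t)) x∈X)
    (fromWitness refl) exchange₀
  where
  Image : (Fin m → Bool) → Fin n → Set
  Image S y = ∃[ v ] (T (S v) × v ≢ x) × f v ≡ y

  image? : ∀ S y → Dec (Image S y)
  image? S y = any? λ v → (T? (S v) ×-dec ¬? (v ≟ x)) ×-dec (f v ≟ y)

  -- The last clause says that `g` sends `S` minus `s` into the columns that `f` gives to `S` minus
  -- `x`. Hence a column outside `Image S` can be in use only by a row outside `S`.
  Exchange : (Fin m → Bool) → Fin m → (Fin m → Fin n) → Set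
  Exchange S s g = (∀ u → ¬ T (S u) → g u ≡ f u) × SDR R (λ u → T (X u) × u ≢ s) g ×
    (∀ u → T (S u) → u ≢ s → Image S (g u))

  S₀ : Fin m → Bool
  S₀ u = ⌊ u ≟ x ⌋

  exchange₀ : ∀ s → T (S₀ s) → ∃ (Exchange S₀ s)
  exchange₀ s t with refl ← toWitness t = f , (λ _ _ → refl) , (f-edge , f-inj) ,
    λ u t u≢ → contradiction (toWitness t) u≢

  search : ∀ S → Acc _<_ (count (λ u → ⌊ ¬? (T? (S u)) ⌋)) → (∀ u → T (S u) → T (X u)) →
    T (S x) → (∀ s → T (S s) → ∃ (Exchange S s)) → (∃[ g ] SDR R (T ∘ X) g) ⊎ Deficient R X
  search S (acc rec) S⊆X x∈S exchange
    with any? (λ s → any? λ y → T? (S s) ×-dec T? (R s y) ×-dec ¬? (image? S y))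
  ... | no ¬∃ = inj₂ record
    { S = S ; root = x ; root∈S = x∈S ; root∈X = x∈X ; f = f
    ; sdr = (λ u (p , ≢) → f-edge u (S⊆X u p , ≢)) ,
            (λ u v (p , ≢) (q , ≢′) → f-inj u v (S⊆X u p , ≢) (S⊆X v q , ≢′))
    ; closed = λ u y s r → decidable-stable (image? S y) (λ ¬i → ¬∃ (u , y , s , r , ¬i)) }
  ... | yes (s , y , s∈S , r , y∉image)
    with g , g-agree , (g-edge , g-inj) , g-image ← exchange s s∈S
    with any? (λ u → (T? (X u) ×-dec ¬? (u ≟ s)) ×-dec (g u ≟ y))
  ... | no ¬∃ = inj₁ (g′ , g′-edge , g′-inj)
    where
    g′ : Fin m → Fin n
    g′ = updateAt g s (const y)
    g′-edge : ∀ u → T (X u) → T (R u (g′ u))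
    g′-edge u u∈X with u ≟ s
    ... | yes refl rewrite updateAt-updates s {const y} g = r
    ... | no u≢s rewrite updateAt-minimal u s {const y} g u≢s = g-edge u (u∈X , u≢s)
    g′-inj : ∀ u v → T (X u) → T (X v) → g′ u ≡ g′ v → u ≡ v
    g′-inj u v u∈X v∈X with u ≟ s | v ≟ s
    ... | yes refl | yes refl = λ _ → refl
    ... | yes refl | no v≢s
      rewrite updateAt-updates s {const y} g | updateAt-minimal v s {const y} g v≢s =
        λ e → contradiction (v , (v∈X , v≢s) , ≡-sym e) ¬∃
    ... | no u≢s | yes refl
      rewrite updateAt-updates s {const y} g | updateAt-minimal u s {const y} g u≢s =
        λ e → contradiction (u , (u∈X , u≢s) , e) ¬∃
    ... | no u≢s | no v≢s
      rewrite updateAt-minimal u s {const y} g u≢s | updateAt-minimal v s {const y} g v≢s =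
        g-inj u v (u∈X , u≢s) (v∈X , v≢s)
  ... | yes (u , (u∈X , u≢s) , gu≡y) =
    search S⁺ (rec smaller) S⁺⊆X (S⊆S⁺ x x∈S) exchange⁺
    where
    u∉S : ¬ T (S u)
    u∉S u∈S = y∉image (subst (Image S) gu≡y (g-image u u∈S u≢s))

    S⁺ : Fin m → Bool
    S⁺ v = ⌊ T? (S v) ⊎-dec (v ≟ u) ⌋
    S⊆S⁺ : ∀ v → T (S v) → T (S⁺ v)
    S⊆S⁺ v p = fromWitness (inj₁ p)
    u∈S⁺ : T (S⁺ u)
    u∈S⁺ = fromWitness (inj₂ refl)
    S⁺⊆X : ∀ v → T (S⁺ v) → T (X v)
    S⁺⊆X v t with toWitness t
    ... | inj₁ p    = S⊆X v p
    ... | inj₂ refl = u∈X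
    smaller : count (λ v → ⌊ ¬? (T? (S⁺ v)) ⌋) < count (λ v → ⌊ ¬? (T? (S v)) ⌋)
    smaller = count-strict _ _ (λ v t → fromWitness (toWitness t ∘ S⊆S⁺ v)) u
      (λ t → toWitness t u∈S⁺) (fromWitness u∉S)

    widen : ∀ {z} → Image S z → Image S⁺ z
    widen (v , (p , v≢x) , e) = v , (S⊆S⁺ v p , v≢x) , e
    image-u : Image S⁺ (f u)
    image-u = u , (u∈S⁺ , λ e → u∉S (subst (T ∘ S) (≡-sym e) x∈S)) , refl
    fu≡y : f u ≡ y
    fu≡y = trans (≡-sym (g-agree u u∉S)) gu≡y

    exchange⁺ : ∀ w → T (S⁺ w) → ∃ (Exchange S⁺ w)
    exchange⁺ w t with toWitness t
    ... | inj₁ w∈S with h , h-agree , h-sdr , h-image ← exchange w w∈S =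
      h , (λ v v∉ → h-agree v (v∉ ∘ S⊆S⁺ v)) , h-sdr , h-image⁺
      where
      h-image⁺ : ∀ v → T (S⁺ v) → v ≢ w → Image S⁺ (h v)
      h-image⁺ v t′ v≢w with toWitness t′
      ... | inj₁ v∈S  = widen (h-image v v∈S v≢w)
      ... | inj₂ refl = subst (Image S⁺) (≡-sym (h-agree u u∉S)) image-u
    -- To leave the new row `u` uncovered, start from the exchange that leaves `s` uncovered and
    -- hand the column `y` of `u` over to `s`.
    ... | inj₂ refl = g′ , g′-agree , (g′-edge , g′-inj) , g′-image
      where
      g′ : Fin m → Fin n
      g′ = updateAt g s (const y)
      g′-agree : ∀ v → ¬ T (S⁺ v) → g′ v ≡ f v
      g′-agree v v∉ = trans
        (updateAt-minimal v s {const y} g (λ e → v∉ (S⊆S⁺ v (subst (T ∘ S) (≡-sym e) s∈S))))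
        (g-agree v (v∉ ∘ S⊆S⁺ v))
      g′-edge : ∀ v → T (X v) × v ≢ u → T (R v (g′ v))
      g′-edge v (v∈X , _) with v ≟ s
      ... | yes refl rewrite updateAt-updates s {const y} g = r
      ... | no v≢s rewrite updateAt-minimal v s {const y} g v≢s = g-edge v (v∈X , v≢s)
      g′-inj : ∀ v w → T (X v) × v ≢ u → T (X w) × w ≢ u → g′ v ≡ g′ w → v ≡ w
      g′-inj v w (v∈X , v≢u) (w∈X , w≢u) with v ≟ s | w ≟ s
      ... | yes refl | yes refl = λ _ → refl
      ... | yes refl | no w≢s
        rewrite updateAt-updates s {const y} g | updateAt-minimal w s {const y} g w≢s =
          λ e → contradiction (g-inj w u (w∈X , w≢s) (u∈X , u≢s) (trans (≡-sym e) (≡-sym gu≡y))) w≢u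
      ... | no v≢s | yes refl
        rewrite updateAt-updates s {const y} g | updateAt-minimal v s {const y} g v≢s =
          λ e → contradiction (g-inj v u (v∈X , v≢s) (u∈X , u≢s) (trans e (≡-sym gu≡y))) v≢u
      ... | no v≢s | no w≢s
        rewrite updateAt-minimal v s {const y} g v≢s | updateAt-minimal w s {const y} g w≢s =
          g-inj v w (v∈X , v≢s) (w∈X , w≢s)
      g′-image : ∀ v → T (S⁺ v) → v ≢ u → Image S⁺ (g′ v)
      g′-image v t′ v≢u with toWitness t′ | v ≟ s
      ... | inj₂ v≡u | _ = contradiction v≡u v≢u
      ... | inj₁ _   | yes refl rewrite updateAt-updates s {const y} g =
            subst (Image S⁺) fu≡y image-u
      ... | inj₁ v∈S | no v≢s rewrite updateAt-minimal v s {const y} g v≢s =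
            widen (g-image v v∈S v≢s)

-- Rows are added one at a time by `augment`; a deficient set found for fewer rows remains one. The
-- column `y₀` supplies the values of the system when `X` is empty.
hall : (R : Edges m n) (y₀ : Fin n) (X : Fin m → Bool) →
  (∃[ g ] SDR R (T ∘ X) g) ⊎ Deficient R X
hall {m} {n} R y₀ X = go X (<-wellFounded (count X))
  where
  go : ∀ X → Acc _<_ (count X) → (∃[ g ] SDR R (T ∘ X) g) ⊎ Deficient R X
  go X (acc rec) with any? (λ x → T? (X x))
  ... | no ¬∃ = inj₁ (const y₀ , (λ u p → contradiction (u , p) ¬∃) ,
                      λ u _ p _ _ → contradiction (u , p) ¬∃)
  ... | yes (x , x∈X) with go (X - x) (rec (count-minus X x x∈X))
  ...   | inj₁ (f , edge , inj) = augment R X x x∈X f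
            ((λ u p → edge u (fromWitness p)) ,
             λ u v p q → inj u v (fromWitness p) (fromWitness q))
  ...   | inj₂ D = inj₂ record
            { S = S ; root = root ; root∈S = root∈S ; root∈X = proj₁ (toWitness root∈X)
            ; f = f ; sdr = sdr ; closed = closed }
          where open Deficient D

-- Rankings of the edges at each vertex

record Peelable (B : Edges m n) : Set where
  field
    M        : Edges m n
    matching : IsMatching B M
    {x₀}     : Fin m
    {y₀}     : Fin n
    nonempty : T (M x₀ y₀)
    lower    : ∀ x y y′ → T (M x y′) → (∀ x′ → ¬ T (M x′ y)) → T (B x y) → colDeg B y < rowDeg B x

-- Edges of `B` outside `Uphill` satisfy the inequality of `lower` automatically, so only these
-- edges constrain the choice of `M`.
Uphill : Edges m n → Edges m n
Uphill B x y = ⌊ T? (B x y) ×-dec (rowDeg B x ≤? colDeg B y) ⌋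

NonIsolated : Edges m n → Fin m → Bool
NonIsolated B x = ⌊ any? (λ y → T? (B x y)) ⌋

graphOf : (P : Fin m → Bool) → (Fin m → Fin n) → Edges m n
graphOf P f x y = ⌊ T? (P x) ×-dec (f x ≟ y) ⌋

sdr-matching : (B : Edges m n) (P : Fin m → Bool) (f : Fin m → Fin n) →
  SDR (Uphill B) (T ∘ P) f → IsMatching B (graphOf P f)
sdr-matching B P f (edge , inj) = record
  { sub    = λ x y t → let p , e = toWitness t in
               subst (T ∘ B x) e (proj₁ (toWitness (edge x p)))
  ; rowUnq = λ x y y′ t t′ → trans (≡-sym (proj₂ (toWitness t))) (proj₂ (toWitness t′))
  ; colUnq = λ x x′ y t t′ → let p , e = toWitness t ; p′ , e′ = toWitness t′ in
               inj x x′ p p′ (trans e (≡-sym e′)) }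

-- Take the matching of `S` minus its root onto the uphill neighbours of `S`: an edge from a covered
-- row to an uncovered column cannot be uphill, because `closed` would cover the column. An uphill
-- edge at the root makes this matching nonempty.
deficient-peelable : (B : Edges m n) → Deficient (Uphill B) (NonIsolated B) → Peelable B
deficient-peelable {m} {n} B D with any? (λ y → T? (Uphill B (Deficient.root D) y))
... | yes (y₁ , up) = record
  { M = graphOf P f
  ; matching = sdr-matching B P f
      ((λ u p → proj₁ sdr u (toWitness p)) ,
       λ u v p q → proj₂ sdr u v (toWitness p) (toWitness q))
  ; nonempty = covered (closed root y₁ root∈S up)
  ; lower = λ x y y′ t uncovered b → ≰⇒> λ le → uncovered _
      (covered (closed x y (proj₁ (toWitness {a? = P? x} (proj₁ (toWitness t))))
        (fromWitness (b , le)))) }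
  where
  open Deficient D
  P? : ∀ u → Dec (T (S u) × u ≢ root)
  P? u = T? (S u) ×-dec ¬? (u ≟ root)
  P : Fin m → Bool
  P u = ⌊ P? u ⌋
  covered : ∀ {y} (i : ∃[ v ] (T (S v) × v ≢ root) × f v ≡ y) → T (graphOf P f (proj₁ i) y)
  covered (v , p , e) = fromWitness (fromWitness p , e)
-- All edges at the root go strictly downhill, so any single one of them can serve as `M`.
... | no ¬up with y₁ , b₁ ← toWitness (Deficient.root∈X D) = record
  { M = graphOf (λ u → ⌊ u ≟ root ⌋) (const y₁)
  ; matching = record
      { sub    = λ x y t → edge (toWitness (proj₁ (toWitness {a? = M? x y} t)))
                                (proj₂ (toWitness {a? = M? x y} t))
      ; rowUnq = λ x y y′ t t′ → trans (≡-sym (proj₂ (toWitness {a? = M? x y} t)))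
                                       (proj₂ (toWitness {a? = M? x y′} t′))
      ; colUnq = λ x x′ y t t′ → trans (toWitness (proj₁ (toWitness {a? = M? x y} t)))
                                 (≡-sym (toWitness (proj₁ (toWitness {a? = M? x′ y} t′)))) }
  ; x₀ = root ; y₀ = y₁
  ; nonempty = fromWitness {a? = M? root y₁} (fromWitness refl , refl)
  ; lower = λ x y y′ t _ b →
      rootLower y (toWitness (proj₁ (toWitness {a? = M? x y′} t))) b }
  where
  open Deficient D
  M? : ∀ u y → Dec (T ⌊ u ≟ root ⌋ × y₁ ≡ y)
  M? u y = T? ⌊ u ≟ root ⌋ ×-dec (y₁ ≟ y)
  edge : ∀ {x y} → x ≡ root → y₁ ≡ y → T (B x y)
  edge refl refl = b₁
  rootLower : ∀ {x} y → x ≡ root → T (B x y) → colDeg B y < rowDeg B x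
  rootLower y refl b = ≰⇒> λ le → ¬up (y , fromWitness (b , le))

-- If neither side has a deficient set, both sides have equally many non-isolated vertices, so the
-- matching that saturates one of them saturates the other.
peelable : (B : Edges m n) (x : Fin m) (y : Fin n) → T (B x y) → Peelable B ⊎ Peelable (flip B)
peelable {m} {n} B x₁ y₁ b₁
  with hall (Uphill B) y₁ (NonIsolated B) | hall (Uphill (flip B)) x₁ (NonIsolated (flip B))
... | inj₂ D | _      = inj₁ (deficient-peelable B D)
... | inj₁ _ | inj₂ D = inj₂ (deficient-peelable (flip B) D)
... | inj₁ (f , edge , inj) | inj₁ (g , edge′ , inj′) = inj₁ record
  { M = graphOf X f
  ; matching = sdr-matching B X f (edge , inj)
  ; nonempty = fromWitness {a? = T? (X x₁) ×-dec (f x₁ ≟ f x₁)} (fromWitness (y₁ , b₁) , refl)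
  ; lower = λ x y _ _ uncovered b → contradiction (saturated x y b uncovered) (<-irrefl refl) }
  where
  X : Fin m → Bool
  X = NonIsolated B
  Y : Fin n → Bool
  Y = NonIsolated (flip B)
  saturated : ∀ x y → T (B x y) → (∀ x′ → ¬ T (graphOf X f x′ y)) → count X < count X
  saturated x y b uncovered = ≤-<-trans
    -- `f` avoids the uncovered column `y`, so `X` is smaller than `Y`, whereas `g` embeds `Y` into
    -- `X`.
    (count-injection X (Y - y) (λ u _ → f u) inj
      (λ u p → fromWitness (fromWitness (u , proj₁ (toWitness (edge u p))) ,
         λ e → uncovered u (fromWitness (p , e)))))
    (<-≤-trans (count-minus Y y (fromWitness (x , b)))
      (count-injection Y X (λ v _ → g v) inj′
        (λ v q → fromWitness (v , proj₁ (toWitness (edge′ v q))))))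

-- `ltY` leaves the rank `colDeg B y` free for an edge that is later put last at `y`; `ltX` does the
-- same after a flip.
record Ranking (B : Edges m n) : Set where
  field
    rX   : Fin m → Fin n → ℕ
    rY   : Fin n → Fin m → ℕ
    injX : RowInjective B rX
    injY : RowInjective (flip B) rY
    ltX  : ∀ x y → T (B x y) → rX x y < rowDeg B x
    ltY  : ∀ x y → T (B x y) → rY y x < colDeg B y
    bound : ∀ x y → T (B x y) → rX x y + rY y x < rowDeg B x ⊔ colDeg B y

flipRanking : (B : Edges m n) → Ranking (flip B) → Ranking B
flipRanking B r = record
  { rX = rY ; rY = rX ; injX = injY ; injY = injX
  ; ltX = λ x y → ltY y x ; ltY = λ x y → ltX y x
  ; bound = λ x y b → subst (_ <_) (⊔-comm (colDeg B y) (rowDeg B x))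
      (subst (_< colDeg B y ⊔ rowDeg B x) (+-comm (rX y x) (rY x y)) (bound y x b)) }
  where open Ranking r

-- An edge of `M` gets rank 0 at its row and the last rank at its column, which is below the column
-- degree. Other edges keep their column rank, and their row rank grows by one exactly when `M`
-- covers the row. If the column is covered too, both degrees have dropped by at least one, which
-- makes up for the growth.
peel-ranking : (B : Edges m n) (p : Peelable B) → Ranking (B ∖ Peelable.M p) → Ranking B
peel-ranking {m} {n} B p r = record
  { rX = rX⁺ ; rY = rY⁺ ; injX = injX⁺ ; injY = injY⁺ ; ltX = ltX⁺ ; ltY = ltY⁺ ; bound = bound⁺ }
  where
  open Peelable p
  open Ranking r
  B⁻ : Edges m n
  B⁻ = B ∖ M
  B⁻⊆B : ∀ x y → T (B⁻ x y) → T (B x y)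
  B⁻⊆B x y = proj₁ ∘ toWitness
  rest : ∀ {x y} → T (B x y) → ¬ T (M x y) → T (B⁻ x y)
  rest b ¬μ = fromWitness (b , ¬μ)

  rowDeg-≤ : ∀ x → rowDeg B⁻ x ≤ rowDeg B x
  rowDeg-≤ x = count-mono (B⁻ x) (B x) (B⁻⊆B x)
  colDeg-≤ : ∀ y → colDeg B⁻ y ≤ colDeg B y
  colDeg-≤ y = count-mono (flip B⁻ y) (flip B y) (λ x → B⁻⊆B x y)
  rowDeg-< : ∀ {x y} → T (M x y) → rowDeg B⁻ x < rowDeg B x
  rowDeg-< {x} {y} μ = count-strict (B⁻ x) (B x) (B⁻⊆B x) y
    (λ t → proj₂ (toWitness t) μ) (sub matching x y μ)
  colDeg-< : ∀ {x y} → T (M x y) → colDeg B⁻ y < colDeg B y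
  colDeg-< {x} {y} μ = count-strict (flip B⁻ y) (flip B y) (λ x → B⁻⊆B x y) x
    (λ t → proj₂ (toWitness t) μ) (sub matching x y μ)

  row? : ∀ x → Dec (∃[ y ] T (M x y))
  row? x = any? (λ y → T? (M x y))
  col? : ∀ y → Dec (∃[ x ] T (M x y))
  col? y = any? (λ x → T? (M x y))

  rX⁺ : Fin m → Fin n → ℕ
  rX⁺ x y with T? (M x y) | row? x
  ... | yes _ | _     = 0
  ... | no _  | yes _ = suc (rX x y)
  ... | no _  | no _  = rX x y

  rY⁺ : Fin n → Fin m → ℕ
  rY⁺ y x with T? (M x y)
  ... | yes _ = colDeg B⁻ y
  ... | no _  = rY y x

  injX⁺ : RowInjective B rX⁺
  injX⁺ x y y′ b b′ with T? (M x y) | T? (M x y′) | row? x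
  ... | yes μ | yes μ′ | _     = λ _ → rowUnq matching x y y′ μ μ′
  ... | yes μ | no _   | yes _ = λ ()
  ... | yes μ | no _   | no ¬∃ = contradiction (y , μ) ¬∃
  ... | no _  | yes _  | yes _ = λ ()
  ... | no _  | yes μ′ | no ¬∃ = contradiction (y′ , μ′) ¬∃
  ... | no ¬μ | no ¬μ′ | yes _ = λ e → injX x y y′ (rest b ¬μ) (rest b′ ¬μ′) (cong pred e)
  ... | no ¬μ | no ¬μ′ | no _  = injX x y y′ (rest b ¬μ) (rest b′ ¬μ′)

  injY⁺ : RowInjective (flip B) rY⁺
  injY⁺ y x x′ b b′ with T? (M x y) | T? (M x′ y)
  ... | yes μ | yes μ′ = λ _ → colUnq matching x x′ y μ μ′
  ... | yes μ | no ¬μ′ = λ e → contradiction (ltY x′ y (rest b′ ¬μ′)) (<-irrefl (≡-sym e))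
  ... | no ¬μ | yes μ′ = λ e → contradiction (ltY x y (rest b ¬μ)) (<-irrefl e)
  ... | no ¬μ | no ¬μ′ = injY y x x′ (rest b ¬μ) (rest b′ ¬μ′)

  ltX⁺ : ∀ x y → T (B x y) → rX⁺ x y < rowDeg B x
  ltX⁺ x y b with T? (M x y) | row? x
  ... | yes μ | _           = ≤-<-trans z≤n (rowDeg-< μ)
  ... | no ¬μ | yes (_ , μ) = ≤-<-trans (ltX x y (rest b ¬μ)) (rowDeg-< μ)
  ... | no ¬μ | no _        = <-≤-trans (ltX x y (rest b ¬μ)) (rowDeg-≤ x)

  ltY⁺ : ∀ x y → T (B x y) → rY⁺ y x < colDeg B y
  ltY⁺ x y b with T? (M x y)
  ... | yes μ = colDeg-< μ
  ... | no ¬μ = <-≤-trans (ltY x y (rest b ¬μ)) (colDeg-≤ y)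

  bound⁺ : ∀ x y → T (B x y) → rX⁺ x y + rY⁺ y x < rowDeg B x ⊔ colDeg B y
  bound⁺ x y b with T? (M x y) | row? x | col? y
  ... | yes μ | _ | _ = <-≤-trans (colDeg-< μ) (m≤n⊔m (rowDeg B x) (colDeg B y))
  ... | no ¬μ | no _ | _ =
        <-≤-trans (bound x y (rest b ¬μ)) (⊔-mono-≤ (rowDeg-≤ x) (colDeg-≤ y))
  ... | no ¬μ | yes (_ , μ) | yes (_ , ν) =
        ≤-<-trans (bound x y (rest b ¬μ)) (⊔-mono-< (rowDeg-< μ) (colDeg-< ν))
  -- The row rank grows although the column degree need not drop. By `lower` both degrees in `B⁻`
  -- are still below `rowDeg B x`, which absorbs the extra one.
  ... | no ¬μ | yes (y′ , μ) | no ¬∃ =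
        ≤-<-trans (bound x y (rest b ¬μ))
          (<-≤-trans (⊔-pres-<m (rowDeg-< μ) (≤-<-trans (colDeg-≤ y)
             (lower x y y′ μ (λ x′ ν → ¬∃ (x′ , ν)) b)))
          (m≤m⊔n (rowDeg B x) (colDeg B y)))

ranking : (B : Edges m n) → Ranking B
ranking {m} {n} B = go B (<-wellFounded (size B))
  where
  go : (B : Edges m n) → Acc _<_ (size B) → Ranking B
  go B (acc rec) with any? (λ x → any? λ y → T? (B x y))
  ... | no ¬∃ = record
    { rX = λ _ _ → 0 ; rY = λ _ _ → 0
    ; injX = λ x y _ b → contradiction (x , y , b) ¬∃
    ; injY = λ y x _ b → contradiction (x , y , b) ¬∃
    ; ltX = λ x y b → contradiction (x , y , b) ¬∃
    ; ltY = λ x y b → contradiction (x , y , b) ¬∃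
    ; bound = λ x y b → contradiction (x , y , b) ¬∃ }
  ... | yes (x , y , b) with peelable B x y b
  ...   | inj₁ p = peel-ranking B p (go (B ∖ M) (rec
            (size-strict (B ∖ M) B (λ _ _ → proj₁ ∘ toWitness) _ _
              (λ t → proj₂ (toWitness t) nonempty) (sub matching _ _ nonempty))))
          where open Peelable p
  -- Here the peeled matching comes first at the columns and last at the rows.
  ...   | inj₂ p = flipRanking B (peel-ranking (flip B) p (flipRanking (flip B ∖ M)
            (go (flip (flip B ∖ M)) (rec
              (size-strict (flip (flip B ∖ M)) B (λ _ _ → proj₁ ∘ toWitness) _ _
                (λ t → proj₂ (toWitness t) nonempty) (sub matching _ _ nonempty))))))
          where open Peelable p

-- List edge colourings of bipartite graphs

record ListColouring (B : Edges m n) (L : Fin m → Fin n → Fin k → Bool) : Set where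
  field
    col     : Fin m → Fin n → Fin k
    allowed : ∀ x y → T (B x y) → T (L x y (col x y))
    rowInj  : ∀ x y y′ → T (B x y) → T (B x y′) → col x y ≡ col x y′ → y ≡ y′
    colInj  : ∀ x x′ y → T (B x y) → T (B x′ y) → col x y ≡ col x′ y → x ≡ x′

-- The classes may overlap; an edge takes the colour that `covers` names. `fallback` fills in at
-- pairs that are not edges, and as a function of the row it also exists when there are neither rows
-- nor colours.
choose-colours : (B : Edges m n) (L : Fin m → Fin n → Fin k → Bool) (C : Fin k → Edges m n) →
  (∀ c → IsMatching (λ x y → L x y c) (C c)) → (∀ x y → T (B x y) → ∃[ c ] T (C c x y)) →
  (Fin m → Fin k) → ListColouring B L
choose-colours {m} {n} {k} B L C classes covers fallback = record
  { col = col
  ; allowed = λ x y b → sub (classes _) x y (col-class x y b)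
  ; rowInj = λ x y y′ b b′ e → rowUnq (classes _) x y y′ (col-class x y b)
      (subst (λ c → T (C c x y′)) (≡-sym e) (col-class x y′ b′))
  ; colInj = λ x x′ y b b′ e → colUnq (classes _) x x′ y (col-class x y b)
      (subst (λ c → T (C c x′ y)) (≡-sym e) (col-class x′ y b′)) }
  where
  col : Fin m → Fin n → Fin k
  col x y with T? (B x y)
  ... | yes b = proj₁ (covers x y b)
  ... | no _  = fallback x
  col-class : ∀ x y → T (B x y) → T (C (col x y) x y)
  col-class x y b with T? (B x y)
  ... | yes b′ = proj₂ (covers x y b′)
  ... | no ¬b  = contradiction b ¬b

-- The theorem of Borodin, Kostochka and Woodall on list edge colourings of bipartite graphs.
list-edge-colouring : (B : Edges m n) (L : Fin m → Fin n → Fin k → Bool) →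
  (∀ x y → T (B x y) → rowDeg B x ⊔ colDeg B y ≤ count (L x y)) →
  (Fin m → Fin k) → ListColouring B L
list-edge-colouring B L large fallback =
  let C , classes , covers = galvin rX rY B L injX injY λ x y b →
        -- Since the ranks at a vertex are distinct, an edge of rank r there has at most r
        -- competitors.
        ≤-<-trans (+-mono-≤ (count-below (B x) (rX x) (λ y y′ → injX x y y′) (rX x y))
                            (count-below (flip B y) (rY y) (λ x x′ → injY y x x′) (rY y x)))
                  (<-≤-trans (bound x y b) (large x y b))
  in choose-colours B L C classes covers fallback
  where open Ranking (ranking B)

-- Extending the colouring

degree≤maxDeg : (G : Graph n) (v : Fin n) → deg G v ≤ maxDeg G
degree≤maxDeg G v = ∈⇒≤ (∈-map⁺ (deg G) (∈-allFin v))
  where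
  ∈⇒≤ : ∀ {a as} → a ∈ as → a ≤ foldr _⊔_ 0 as
  ∈⇒≤ {as = b ∷ as} (here refl) = m≤m⊔n b _
  ∈⇒≤ {as = b ∷ as} (there a∈)  = ≤-trans (∈⇒≤ a∈) (m≤n⊔m b _)

ProperOn : Graph n → (Fin n → Set) → (Fin n → Fin k) → Set
ProperOn G W f = ∀ u v → W u → W v → T (adj G u v) → f u ≢ f v

extend-vertices : (G : Graph n) (Δ : ℕ) → (∀ v → deg G v ≤ Δ) → Δ < k →
  (W : Fin n → Bool) (f : Fin n → Fin k) → ProperOn G (T ∘ W) f →
  Σ (Fin n → Fin k) λ g → (∀ u v → T (adj G u v) → g u ≢ g v) × (∀ v → T (W v) → g v ≡ f v)
extend-vertices {n} {k} G Δ deg≤Δ Δ<k W f proper = go W (<-wellFounded _) f proper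
  where
  go : ∀ W → Acc _<_ (count (λ v → ⌊ ¬? (T? (W v)) ⌋)) → (f : Fin n → Fin k) →
    ProperOn G (T ∘ W) f →
    Σ (Fin n → Fin k) λ g → (∀ u v → T (adj G u v) → g u ≢ g v) × (∀ v → T (W v) → g v ≡ f v)
  go W (acc rec) f proper with any? (λ v → ¬? (T? (W v)))
  ... | no ¬∃ = f , (λ u v → proper u v (all u) (all v)) , λ _ _ → refl
    where
    all : ∀ v → T (W v)
    all v = decidable-stable (T? (W v)) (λ ¬w → ¬∃ (v , ¬w))
  ... | yes (v , v∉W)
    -- The new colour avoids the values of `f` at all neighbours, including the provisional values
    -- outside `W`; there are at most `Δ` of them.
    with c , free ← free-value (adj G v) f (≤-<-trans (deg≤Δ v) Δ<k)
    = let g , g-proper , g-agree = go W⁺ (rec smaller) f⁺ proper⁺ in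
      g , g-proper , λ u u∈W → trans (g-agree u (fromWitness (inj₁ u∈W)))
        (updateAt-minimal u v f (≢v u∈W))
    where
    W⁺ : Fin n → Bool
    W⁺ u = ⌊ T? (W u) ⊎-dec (u ≟ v) ⌋
    f⁺ : Fin n → Fin k
    f⁺ = updateAt f v (const c)
    smaller : count (λ u → ⌊ ¬? (T? (W⁺ u)) ⌋) < count (λ u → ⌊ ¬? (T? (W u)) ⌋)
    smaller = count-strict _ _
      (λ u t → fromWitness (λ w → toWitness t (fromWitness (inj₁ w)))) v
      (λ t → toWitness t (fromWitness (inj₂ refl))) (fromWitness v∉W)
    ≢v : ∀ {u} → T (W u) → u ≢ v
    ≢v u∈W refl = v∉W u∈W
    proper⁺ : ProperOn G (T ∘ W⁺) f⁺
    proper⁺ u w u∈ w∈ a with toWitness u∈ | toWitness w∈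
    ... | inj₂ refl | inj₂ refl = λ _ → subst T (irrefl G v) a
    ... | inj₂ refl | inj₁ q
      rewrite updateAt-updates v {const c} f | updateAt-minimal w v {const c} f (≢v q) =
        free w a ∘ ≡-sym
    ... | inj₁ p | inj₂ refl
      rewrite updateAt-updates v {const c} f | updateAt-minimal u v {const c} f (≢v p) =
        free u (subst T (sym G u v) a)
    ... | inj₁ p | inj₁ q
      rewrite updateAt-minimal u v {const c} f (≢v p) | updateAt-minimal w v {const c} f (≢v q) =
        proper u w p q a

-- Colouring the edges outside the subgraph

T-ext : ∀ a b → (T a → T b) → (T b → T a) → a ≡ b
T-ext false false _ _ = refl
T-ext true  true  _ _ = refl
T-ext true  false f _ with () ← f tt
T-ext false true  _ g with () ← g tt

-- Here `a` and `h` are the degrees of one end among the uncoloured edges and in `H`, `h′` is the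
-- degree of the other end in `H`, and `l` is the length of the list. The part `Δ` of `k` pays for
-- `a + h`, the part `d` for `h′`, and the 2 for the colours of the two ends.
room-for : ∀ {k} Δ d a h h′ l → Δ + d + 2 ≤ k → a + h ≤ Δ → h′ ≤ d → k ≤ l + (suc h + suc h′) → a ≤ l
room-for {k} Δ d a h h′ l Δ+d+2≤k a+h≤Δ h′≤d k≤ = +-cancelʳ-≤ (suc h + suc h′) a l (begin
  a + (suc h + suc h′)    ≡⟨ +-assoc a (suc h) (suc h′) ⟨
  (a + suc h) + suc h′    ≡⟨ cong (_+ suc h′) (+-suc a h) ⟩
  suc (a + h) + suc h′    ≡⟨ +-suc (suc (a + h)) h′ ⟩
  2 + (a + h + h′)        ≤⟨ +-monoʳ-≤ 2 (+-mono-≤ a+h≤Δ h′≤d) ⟩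
  2 + (Δ + d)             ≡⟨ +-comm 2 (Δ + d) ⟩
  Δ + d + 2               ≤⟨ Δ+d+2≤k ⟩
  k                       ≤⟨ k≤ ⟩
  l + (suc h + suc h′)    ∎)
  where open ≤-Reasoning

module _ (G : Graph n) (side : Fin n → Bool) (H : Subgraph G)
         (vc : Fin n → Fin k) (ec : Fin n → Fin n → Fin k) where

  -- Index zero stands for the vertex v itself, index suc u for the edge vu.
  present : Fin n → Fin (suc n) → Bool
  present v = true ∷ᵛ hadj H v
  colour : Fin n → Fin (suc n) → Fin k
  colour v = vc v ∷ᵛ ec v
  blocked : Fin n → Fin k → Bool
  blocked v = image (present v) (colour v)
  count-blocked : ∀ v → count (blocked v) ≤ suc (hdeg H v)
  count-blocked v = ≤-trans (count-image (present v) (colour v)) (≤-reflexive (count-suc (present v)))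

  Uncoloured : Edges n n
  Uncoloured x y =
    ⌊ (T? (adj G x y) ×-dec ¬? (T? (hadj H x y))) ×-dec (T? (side x) ×-dec ¬? (T? (side y))) ⌋
  Allowed : Fin n → Fin n → Fin k → Bool
  Allowed x y c = ⌊ ¬? (T? (blocked x c) ⊎-dec T? (blocked y c)) ⌋

  hadj⇒adj : ∀ {u v} → T (hadj H u v) → T (adj G u v)
  hadj⇒adj = hsub H _ _
  adj-sym : ∀ {u v} → T (adj G u v) → T (adj G v u)
  adj-sym {u} {v} = subst T (sym G u v)
  hadj-sym : ∀ {u v} → T (hadj H u v) → T (hadj H v u)
  hadj-sym {u} {v} = subst T (hsym H u v)

  rowDeg-uncoloured : ∀ x → rowDeg Uncoloured x + hdeg H x ≤ deg G x
  rowDeg-uncoloured x =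
    count-disjoint (Uncoloured x) (hadj H x) (adj G x) (λ y t → proj₁ (proj₁ (toWitness t)))
      (λ _ → hadj⇒adj) (λ y t → proj₂ (proj₁ (toWitness t)))
  colDeg-uncoloured : ∀ y → colDeg Uncoloured y + hdeg H y ≤ deg G y
  colDeg-uncoloured y =
    count-disjoint (flip Uncoloured y) (hadj H y) (adj G y)
      (λ x t → adj-sym (proj₁ (proj₁ (toWitness t))))
      (λ _ → hadj⇒adj) (λ x t h → proj₂ (proj₁ (toWitness t)) (hadj-sym h))

  count-allowed : ∀ x y → k ≤ count (Allowed x y) + (suc (hdeg H x) + suc (hdeg H y))
  count-allowed x y = begin
    k
      ≡⟨ count-full k ⟨
    count {k} (const true)
      ≤⟨ count-∪ (Allowed x y) either (const true) (λ c _ → split c) ⟩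
    count (Allowed x y) + count either
      ≤⟨ +-monoʳ-≤ (count (Allowed x y))
           (count-∪ (blocked x) (blocked y) either (λ c → toWitness)) ⟩
    count (Allowed x y) + (count (blocked x) + count (blocked y))
      ≤⟨ +-monoʳ-≤ (count (Allowed x y)) (+-mono-≤ (count-blocked x) (count-blocked y)) ⟩
    count (Allowed x y) + (suc (hdeg H x) + suc (hdeg H y))
      ∎
    where
    open ≤-Reasoning
    either : Fin k → Bool
    either c = ⌊ T? (blocked x c) ⊎-dec T? (blocked y c) ⌋
    split : ∀ c → T (Allowed x y c) ⊎ T (either c)
    split c with T? (blocked x c) ⊎-dec T? (blocked y c)
    ... | yes _ = inj₂ tt
    ... | no _  = inj₁ tt

  module _ (Δ d : ℕ) (deg≤Δ : ∀ v → deg G v ≤ Δ) (hdeg≤d : ∀ v → hdeg H v ≤ d)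
           (Δ+d+2≤k : Δ + d + 2 ≤ k) where

    colour-uncoloured : ListColouring Uncoloured Allowed
    colour-uncoloured = list-edge-colouring Uncoloured Allowed (λ x y _ → ⊔-lub
      (room-for Δ d _ (hdeg H x) (hdeg H y) _ Δ+d+2≤k
        (≤-trans (rowDeg-uncoloured x) (deg≤Δ x)) (hdeg≤d y) (count-allowed x y))
      (room-for Δ d _ (hdeg H y) (hdeg H x) _ Δ+d+2≤k
        (≤-trans (colDeg-uncoloured y) (deg≤Δ y)) (hdeg≤d x)
        (subst (λ s → k ≤ count (Allowed x y) + s) (+-comm (suc (hdeg H x)) (suc (hdeg H y)))
          (count-allowed x y)))) vc

  module _ (bipartite : ∀ u v → T (adj G u v) → side u ≢ side v)
           (colouring : ListColouring Uncoloured Allowed) where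
    open ListColouring colouring

    -- On new edges `col` is always read with the end on the true side first, which makes both
    -- orientations get the same colour.
    ec′ : Fin n → Fin n → Fin k
    ec′ u v = if hadj H u v then ec u v else if side u then col u v else col v u

    ec′-agrees : ∀ u v → T (hadj H u v) → ec′ u v ≡ ec u v
    ec′-agrees u v h with true ← hadj H u v = refl

    ec′-row : ∀ u v → ¬ T (hadj H u v) → T (side u) → ec′ u v ≡ col u v
    ec′-row u v ¬h s with hadj H u v | side u
    ... | false | true = refl
    ... | true  | _    = contradiction tt ¬h
    ec′-column : ∀ u v → ¬ T (hadj H u v) → ¬ T (side u) → ec′ u v ≡ col v u
    ec′-column u v ¬h ¬s with hadj H u v | side u
    ... | false | false = refl
    ... | false | true  = contradiction tt ¬s
    ... | true  | _     = contradiction tt ¬h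

    -- An uncoloured edge seen from `u`, which is either its row or its column.
    data Fresh (u v : Fin n) : Set where
      row    : ¬ T (side v) → T (Uncoloured u v) → ec′ u v ≡ col u v → Fresh u v
      column : T (side v) → T (Uncoloured v u) → ec′ u v ≡ col v u → Fresh u v

    fresh : ∀ u v → T (adj G u v) → ¬ T (hadj H u v) → Fresh u v
    fresh u v a ¬h with T? (side u) | T? (side v)
    ... | yes s | no ¬t = row ¬t (fromWitness ((a , ¬h) , s , ¬t)) (ec′-row u v ¬h s)
    ... | no ¬s | yes t = column t (fromWitness ((adj-sym a , ¬h ∘ hadj-sym) , t , ¬s))
          (ec′-column u v ¬h ¬s)
    ... | yes s | yes t = contradiction (T-ext _ _ (const t) (const s)) (bipartite u v a)
    ... | no ¬s | no ¬t = contradiction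
          (T-ext _ _ (λ s → contradiction s ¬s) (λ t → contradiction t ¬t)) (bipartite u v a)

    ec′-sym : (∀ u v → T (hadj H u v) → ec u v ≡ ec v u) →
      ∀ u v → T (adj G u v) → ec′ u v ≡ ec′ v u
    ec′-sym ec-sym u v a with T? (hadj H u v)
    ... | yes h = trans (ec′-agrees u v h)
          (trans (ec-sym u v h) (≡-sym (ec′-agrees v u (hadj-sym h))))
    ... | no ¬h with fresh u v a ¬h
    ...   | row ¬t _ e   = trans e (≡-sym (ec′-column v u (¬h ∘ hadj-sym) ¬t))
    ...   | column t _ e = trans e (≡-sym (ec′-row v u (¬h ∘ hadj-sym) t))

    -- This excludes clashes with the colour of `u` and with the edges of `H` at `u` at once,
    -- because `blocked u` collects both kinds of colours.
    fresh-unblocked : ∀ u v → T (adj G u v) → ¬ T (hadj H u v) → ¬ T (blocked u (ec′ u v))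
    fresh-unblocked u v a ¬h b with fresh u v a ¬h
    ... | row _ p e    = toWitness (allowed u v p) (inj₁ (subst (T ∘ blocked u) e b))
    ... | column _ p e = toWitness (allowed v u p) (inj₂ (subst (T ∘ blocked u) e b))

    fresh-proper : ∀ u v w → T (adj G u v) → ¬ T (hadj H u v) → T (adj G u w) → ¬ T (hadj H u w) →
      ec′ u v ≡ ec′ u w → v ≡ w
    fresh-proper u v w a ¬h a′ ¬h′ e with fresh u v a ¬h | fresh u w a′ ¬h′
    ... | row _ p eq    | row _ p′ eq′    = rowInj u v w p p′ (trans (≡-sym eq) (trans e eq′))
    ... | column _ p eq | column _ p′ eq′ = colInj v w u p p′ (trans (≡-sym eq) (trans e eq′))
    ... | row _ p _     | column _ p′ _   =
          contradiction (proj₁ (proj₂ (toWitness p))) (proj₂ (proj₂ (toWitness p′)))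
    ... | column _ p _  | row _ p′ _      =
          contradiction (proj₁ (proj₂ (toWitness p′))) (proj₂ (proj₂ (toWitness p)))

    ec′-proper : (∀ u v w → T (hadj H u v) → T (hadj H u w) → v ≢ w → ec u v ≢ ec u w) →
      ∀ u v w → T (adj G u v) → T (adj G u w) → v ≢ w → ec′ u v ≢ ec′ u w
    ec′-proper ec-proper u v w a a′ v≢w e with T? (hadj H u v) | T? (hadj H u w)
    ... | yes h | yes h′ = ec-proper u v w h h′ v≢w
          (trans (≡-sym (ec′-agrees u v h)) (trans e (ec′-agrees u w h′)))
    ... | yes h | no ¬h′ = fresh-unblocked u w a′ ¬h′
          (fromWitness (suc v , h , trans (≡-sym (ec′-agrees u v h)) e))
    ... | no ¬h | yes h′ = fresh-unblocked u v a ¬h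
          (fromWitness (suc w , h′ , trans (≡-sym (ec′-agrees u w h′)) (≡-sym e)))
    ... | no ¬h | no ¬h′ = v≢w (fresh-proper u v w a ¬h a′ ¬h′ e)

    ec′-end : (∀ u v → T (hadj H u v) → ec u v ≢ vc u) →
      ∀ u v → T (adj G u v) → ec′ u v ≢ vc u
    ec′-end ec-end u v a e with T? (hadj H u v)
    ... | yes h = ec-end u v h (trans (≡-sym (ec′-agrees u v h)) e)
    ... | no ¬h = fresh-unblocked u v a ¬h (fromWitness (zero , tt , ≡-sym e))

extend-total-colouring : (G : Graph n) → Bipartite G → (H : Subgraph G) (Δ d : ℕ) →
  (∀ v → deg G v ≤ Δ) → (∀ v → hdeg H v ≤ d) → Δ + d + 2 ≤ k →
  (vc : Fin n → Fin k) (ec : Fin n → Fin n → Fin k) →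
  IsTotalColoringIn G H vc ec → Extends G H vc ec
extend-total-colouring G (side , bipartite) H Δ d deg≤Δ hdeg≤d Δ+d+2≤k vc ec
  (vc-proper , ec-sym , ec-proper , ec-end) =
  let vc′ , vc′-proper , vc′-agrees = extend-vertices G Δ deg≤Δ Δ<k (inV H) vc vc-proper
      colouring = colour-uncoloured G side H vc′ ec Δ d deg≤Δ hdeg≤d Δ+d+2≤k
  in vc′ , ec′ G side H vc′ ec bipartite colouring ,
     (vc′-proper ,
      ec′-sym G side H vc′ ec bipartite colouring ec-sym ,
      ec′-proper G side H vc′ ec bipartite colouring ec-proper ,
      ec′-end G side H vc′ ec bipartite colouring
        -- The edges were coloured against `vc′`, whereas the hypothesis speaks of `vc`; the ends of
        -- an edge of `H` lie in `H`, where the two agree.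
        (λ u v h e → ec-end u v h (trans e (vc′-agrees u (hend H u v h))))) ,
     vc′-agrees , ec′-agrees G side H vc′ ec bipartite colouring
  where
  Δ<k = <-≤-trans (≤-<-trans (m≤m+n Δ d) (m<m+n (Δ + d) (s≤s z≤n))) Δ+d+2≤k

theorem4p4 : (n : ℕ) (G : Graph n) → Planar G → Bipartite G →
    (H : Subgraph G) (d : ℕ) → (∀ v → hdeg H v ≤ d) →
    (vc : Fin n → Fin (maxDeg G + d + 4)) (ec : Fin n → Fin n → Fin (maxDeg G + d + 4)) →
    IsTotalColoringIn G H vc ec → Extends G H vc ec
theorem4p4 n G _ bip H d hdeg≤d vc ec =
  extend-total-colouring G bip H (maxDeg G) d (degree≤maxDeg G) hdeg≤d
    (+-monoʳ-≤ (maxDeg G + d) (s≤s (s≤s z≤n))) vc ec
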